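{- Let $a\in Ag$, let $\chi,\lambda$ be propositional formulas and let $\varphi,\psi\in\mathcal{L}^{\div}$. The following formulas are valid in $\mathsf{HPAL}$ (i.e. in the class of all Kripke models): 1. (Propositional Inclusion) $[\div\varphi]B_a\chi\to B_a\chi$. 2. (Propositional Conjunctive Inclusion) $[\div(\lambda\wedge\psi)]\neg B_a\lambda\to([\div(\lambda\wedge\psi)]B_a\chi\to[\div\lambda]B_a\chi)$. 3. (Propositional Conjunctive Overlap) $([\div\varphi]B_a\chi\wedge[\div\psi]B_a\chi)\to[\div(\varphi\wedge\psi)]B_a\chi$.
   Context: Language. $At$ is a countable set of atoms, $Ag$ a finite set of agents. The contraction language $\mathcal{L}^{\div}$ is given by $\varphi::=\top\mid p\mid\neg\varphi\mid\varphi\wedge\varphi\mid B_a\varphi\mid[\div\varphi]\varphi\mid\forall\varphi$ with $p\in At$, $a\in Ag$; the other Boolean connectives are the usual abbreviations. A formula is propositional if it is built from $\top$ and atoms using Boolean connectives only. Semantics. A Kripke model is $\mathcal{M}=(W,R,V)$ with $W\neq\emptyset$, $R_a\subseteq W\times W$ an arbitrary relation for each $a\in Ag$, $V:At\to\wp(W)$; $R_a(w)=\{v:(w,v)\in R_a\}$. Atoms and Booleans are standard; $\mathcal{M},w\vDash B_a\varphi$ iff $\mathcal{M},v\vDash\varphi$ for all $v\in R_a(w)$; $\mathcal{M},w\vDash\forall\varphi$ iff $\mathcal{M},v\vDash\varphi$ for all $v\in W$; $\mathcal{M},w\vDash[\div\varphi]\psi$ iff $\mathcal{M}^{\div\varphi},w\vDash\psi$,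 where $\mathcal{M}^{\div\varphi}=(W,R^{\div\varphi},V)$ with $R_a^{\div\varphi}(w)=R_a(w)\cup\{v\in W:\mathcal{M},v\vDash\neg\varphi\}$ if $\mathcal{M},w\vDash B_a\varphi$, and $R_a^{\div\varphi}(w)=R_a(w)$ otherwise. A formula is valid in a class of models if it is true at every world of every model in the class. -}

module Defs where

open import Level using (Level; suc)
open import Data.Nat using (ℕ)
open import Data.Fin using (Fin)
open import Data.Product using (_×_; ∃-syntax)
open import Data.Sum using (_⊎_)
open import Data.Unit.Polymorphic using (⊤)
open import Function.Bundles using (_↣_; _↔_)
open import Relation.Nullary using (¬_)

private variable
  At Ag : Set
  ℓ : Level

Countable : Set → Set
Countable A = A ↣ ℕ

Finite : Set → Set
Finite A = ∃[ n ] (A ↔ Fin n)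

infix  9 ¬′_
infixr 8 [÷_]_
infixr 7 _∧′_
infixr 6 _⇒′_

data Formula (At Ag : Set) : Set where
  ⊤′    : Formula At Ag
  atom  : At → Formula At Ag
  ¬′_   : Formula At Ag → Formula At Ag
  _∧′_  : Formula At Ag → Formula At Ag → Formula At Ag
  B     : Ag → Formula At Ag → Formula At Ag
  [÷_]_ : Formula At Ag → Formula At Ag → Formula At Ag
  ∀′    : Formula At Ag → Formula At Ag

_⇒′_ : Formula At Ag → Formula At Ag → Formula At Ag
φ ⇒′ ψ = ¬′ (φ ∧′ ¬′ ψ)

data Propositional {At Ag : Set} : Formula At Ag → Set where
  ⊤′   : Propositional ⊤′
  atom : ∀ p → Propositional (atom p)
  ¬′_  : ∀ {φ} → Propositional φ → Propositional (¬′ φ)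
  _∧′_ : ∀ {φ ψ} → Propositional φ → Propositional ψ → Propositional (φ ∧′ ψ)

-- A single level ℓ serves worlds, accessibility and valuation, so that
-- contracting a model does not change its level.
record Model (At Ag : Set) (ℓ : Level) : Set (suc ℓ) where
  field
    W        : Set ℓ
    nonempty : W
    R        : Ag → W → W → Set ℓ
    V        : At → W → Set ℓ

-- Contraction by the truth set P = { v ∣ M , v ⊨ φ }, so that it can be defined
-- before satisfaction.  The condition w ⊨ B_a φ of the case distinction (in
-- which R_a is unchanged otherwise) is conjoined to the added disjunct.
contract : (M : Model At Ag ℓ) → (Model.W M → Set ℓ) → Model At Ag ℓ
contract M P = record
  { W        = W
  ; nonempty = nonempty
  ; R        = λ a w v → R a w v ⊎ ((∀ u → R a w u → P u) × ¬ P v)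
  ; V        = V
  }
  where open Model M

open Model

infix 4 _,_⊨_

_,_⊨_ : (M : Model At Ag ℓ) → W M → Formula At Ag → Set ℓ
M , w ⊨ ⊤′         = ⊤
M , w ⊨ atom p     = V M p w
M , w ⊨ ¬′ φ       = ¬ (M , w ⊨ φ)
M , w ⊨ (φ ∧′ ψ)   = (M , w ⊨ φ) × (M , w ⊨ ψ)
M , w ⊨ B a φ      = ∀ v → R M a w v → M , v ⊨ φ
M , w ⊨ ([÷ φ ] ψ) = contract M (λ v → M , v ⊨ φ) , w ⊨ ψ
M , w ⊨ ∀′ φ       = ∀ v → M , v ⊨ φ

-- Validity in the class of all Kripke models (of level ℓ).
HPAL-Valid : (ℓ : Level) → Formula At Ag → Set (suc ℓ)
HPAL-Valid {At} {Ag} ℓ φ = (M : Model At Ag ℓ) (w : W M) → M , w ⊨ φ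

{-# OPTIONS --safe #-}
module Submission where

open import Defs
open import Level using (Level)
open import Axiom.ExcludedMiddle using (ExcludedMiddle)
open import Data.Empty using (⊥-elim)
open import Data.Product using (_×_; _,_; proj₁; proj₂)
open import Data.Sum using (inj₁; inj₂)
open import Function using (id; _∘_)
open import Relation.Binary.PropositionalEquality using (_≡_; refl; sym; cong; cong₂; subst)
open import Relation.Nullary using (¬_; yes; no)

-- Contraction changes only the accessibility relations, so it preserves the
-- truth set of a propositional χ; each claim then compares the successors of a
-- world under two contractions.  For (2): at a world with B_a θ, if
-- B_a (θ ∧ ψ) failed, then contracting by θ ∧ ψ would change nothing there and
-- B_a θ would survive, against the hypothesis; hence every ¬θ-world, being a
-- ¬(θ ∧ ψ)-world, is already accessible after contracting by θ ∧ ψ.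

private variable
  At Ag : Set
  ℓ : Level

module _ (M : Model At Ag ℓ) where
  open Model M

  -- An equality of types rather than an implication, so that negation, which reverses implications,
  -- is a plain congruence.
  propositional-invariant : ∀ (P : W → Set ℓ) {w} {χ : Formula At Ag} → Propositional χ →
    (contract M P , w ⊨ χ) ≡ (M , w ⊨ χ)
  propositional-invariant P ⊤′       = refl
  propositional-invariant P (atom p) = refl
  propositional-invariant P (¬′ π)   = cong ¬_ (propositional-invariant P π)
  propositional-invariant P (π ∧′ ρ) =
    cong₂ _×_ (propositional-invariant P π) (propositional-invariant P ρ)

  module _ {P : W → Set ℓ} {χ : Formula At Ag} (π : Propositional χ) where

    fromContract : ∀ {w} → contract M P , w ⊨ χ → M , w ⊨ χ
    fromContract = subst id (propositional-invariant P π)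

    toContract : ∀ {w} → M , w ⊨ χ → contract M P , w ⊨ χ
    toContract = subst id (sym (propositional-invariant P π))

module _ {a : Ag} {χ : Formula At Ag} (π : Propositional χ) (M : Model At Ag ℓ) {w : Model.W M} where

  -- Contraction only adds successors: every old one survives as `inj₁`.
  inclusion : ∀ φ → M , w ⊨ ([÷ φ ] B a χ) → M , w ⊨ B a χ
  inclusion φ Bχ v r = fromContract M π (Bχ v (inj₁ r))

  conjunctiveInclusion : ExcludedMiddle ℓ → ∀ {θ} → Propositional θ → ∀ ψ →
    M , w ⊨ ([÷ (θ ∧′ ψ) ] (¬′ B a θ)) →
    M , w ⊨ ([÷ (θ ∧′ ψ) ] B a χ) → M , w ⊨ ([÷ θ ] B a χ)
  conjunctiveInclusion em {θ} ρ ψ ¬Bθ Bχ v (inj₁ r) =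
    toContract M π (inclusion (θ ∧′ ψ) Bχ v r)
  conjunctiveInclusion em {θ} ρ ψ ¬Bθ Bχ v (inj₂ (Bθ , ¬θ))
    with em {M , w ⊨ B a (θ ∧′ ψ)}
  -- The two contracted models differ, so the truth of `χ` at `v` passes from one to the other
  -- through `M`.
  ... | yes Bθψ = toContract M π (fromContract M π (Bχ v (inj₂ (Bθψ , ¬θ ∘ proj₁))))
  ... | no ¬Bθψ = ⊥-elim (¬Bθ λ where
    u (inj₁ r)         → toContract M ρ (Bθ u r)
    u (inj₂ (Bθψ , _)) → ⊥-elim (¬Bθψ Bθψ))

  -- A new successor falsifies `φ` or `ψ`. Belief in the conjunction gives belief in that conjunct,
  -- so contracting by it alone already adds this successor.
  conjunctiveOverlap : ExcludedMiddle ℓ → ∀ φ ψ →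
    M , w ⊨ ([÷ φ ] B a χ) → M , w ⊨ ([÷ ψ ] B a χ) → M , w ⊨ ([÷ (φ ∧′ ψ) ] B a χ)
  conjunctiveOverlap em φ ψ Bχ Bχ′ v (inj₁ r) = toContract M π (inclusion φ Bχ v r)
  conjunctiveOverlap em φ ψ Bχ Bχ′ v (inj₂ (Bφψ , ¬φψ)) with em {M , v ⊨ φ}
  ... | yes p = toContract M π (fromContract M π
    (Bχ′ v (inj₂ ((λ u r → proj₂ (Bφψ u r)) , λ q → ¬φψ (p , q)))))
  ... | no ¬p = toContract M π (fromContract M π
    (Bχ v (inj₂ ((λ u r → proj₁ (Bφψ u r)) , ¬p))))

proposition6p3 : (ℓ : Level) → ExcludedMiddle ℓ →
    (At Ag : Set) → Countable At → Finite Ag →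
    (a : Ag) (χ θ : Formula At Ag) → Propositional χ → Propositional θ →
    (φ ψ : Formula At Ag) →
    HPAL-Valid ℓ (([÷ φ ] B a χ) ⇒′ B a χ)
    × HPAL-Valid ℓ (([÷ (θ ∧′ ψ) ] (¬′ B a θ)) ⇒′ (([÷ (θ ∧′ ψ) ] B a χ) ⇒′ ([÷ θ ] B a χ)))
    × HPAL-Valid ℓ ((([÷ φ ] B a χ) ∧′ ([÷ ψ ] B a χ)) ⇒′ ([÷ (φ ∧′ ψ) ] B a χ))
proposition6p3 ℓ em At Ag _ _ a χ θ π ρ φ ψ =
    (λ M w (Bχ , ¬goal) → ¬goal (inclusion π M φ Bχ))
  , (λ M w (¬Bθ , ¬goal) → ¬goal λ (Bχ , ¬goal′) →
      ¬goal′ (conjunctiveInclusion π M em ρ ψ ¬Bθ Bχ))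
  , (λ M w ((Bχ , Bχ′) , ¬goal) → ¬goal (conjunctiveOverlap π M em φ ψ Bχ Bχ′))
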